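{- An ST graph $G$ with no twins is WDI if and only if (i) $D=\mathrm{Join}(G)$ is transitive, and (ii) for every arc $a\to b$ of $D$ there exists a vertex $c$ of $D$ such that $a\to c$ and $c\to b$ are arcs of $D$.
   Context: A digraph is a finite vertex set $V$ with arc set $E\subseteq V\times V$. $N^+(v),N^-(v)$ are out-/in-neighborhoods, $N(v)=N^+(v)\cup N^-(v)$, $d(v)=|N(v)|$. Source: $N^-(v)=\emptyset$; sink: $N^+(v)=\emptyset$; ST graph: every vertex is a source or a sink. Two distinct vertices of an ST graph are twins if $N(v)=N(w)$. A vertex $u$ is transitive if $x\to y$ is an arc for all $x\in N^-(u)$, $y\in N^+(u)$; a digraph is transitive if all its vertices are. An arc $v\to w$ is disimplicial if $x\to y$ is an arc for all $x\in N^-(w)$, $y\in N^+(v)$. A diclique is a pair $(V,W)$ of nonempty vertex sets, written $V\to W$, with $v\to w$ an arc for all $v\in V,w\in W$; an arc $v\to w$ belongs to it if $v\in V,w\in W$; it is maximal if not properly contained componentwise in another diclique; it is reduced if maximal and containing a disimplicial arc. A digraph is WDI if every arc belongs to a reduced diclique. The thin neighbor $\theta(v)$ is the unique $x\in N(v)$ with $d(x)<d(z)$ for all $z\in N(v)\setminus\{x\}$ (undefined if none); an arc $v\to w$ is thin if $\theta(v)=w$ and $\theta(w)=v$; thin arcs form a matching $M$ (no two share an endpoint); $V(M)$ is its endpoint set. $\mathrm{Join}(G)$ is the digraph with a vertex $(v,v)$ for each $v\notin V(M)$ and a vertex $(v,w)$ for each $v\to w\in M$, with $(v,w)\to(x,y)$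 an arc iff $v\to y\in E(G)$. -}

module Defs where

open import Data.Fin.Base using (Fin)
open import Data.Fin.Properties using (_≟_; all?; any?)
open import Data.Fin.Subset using (Subset; _∈_; _⊆_; _∪_; ∣_∣; Nonempty; Empty)
open import Data.Fin.Subset.Properties using (_∈?_)
open import Data.List.Base using (List; allFin; cartesianProduct; filter; length; lookup)
open import Data.Nat.Base using (ℕ; _<_)
open import Data.Nat.Properties using (_<?_; <-asym)
open import Data.Product.Base using (_×_; _,_; ∃; ∃-syntax; ∃₂; proj₁; proj₂)
open import Data.Sum.Base using (_⊎_)
open import Data.Vec.Base using (tabulate)
open import Relation.Binary.Definitions using (Decidable)
open import Relation.Binary.PropositionalEquality using (_≡_; _≢_; sym)
import Relation.Unary as U
open import Relation.Nullary using (¬_; yes; no; does; contradiction)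
open import Relation.Nullary.Decidable using (¬?; _×-dec_; _⊎-dec_; _→-dec_)

-- Loops are allowed.
record Digraph : Set₁ where
  field
    order : ℕ
    _⟶_   : Fin order → Fin order → Set
    _⟶?_  : Decidable _⟶_

  infix 4 _⟶_ _⟶?_

  Vertex : Set
  Vertex = Fin order

  N⁺ N⁻ N : Vertex → Subset order
  N⁺ v = tabulate λ w → does (v ⟶? w)
  N⁻ v = tabulate λ w → does (w ⟶? v)
  N v  = N⁺ v ∪ N⁻ v

  d : Vertex → ℕ
  d v = ∣ N v ∣

  Source Sink : Vertex → Set
  Source v = Empty (N⁻ v)
  Sink v   = Empty (N⁺ v)

  ST : Set
  ST = ∀ v → Source v ⊎ Sink v

  Twins : Vertex → Vertex → Set
  Twins v w = v ≢ w × N v ≡ N w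

  TransitiveVertex : Vertex → Set
  TransitiveVertex u = ∀ x y → x ∈ N⁻ u → y ∈ N⁺ u → x ⟶ y

  Transitive : Set
  Transitive = ∀ u → TransitiveVertex u

  DisimplicialArc : Vertex → Vertex → Set
  DisimplicialArc v w = v ⟶ w × (∀ x y → x ∈ N⁻ w → y ∈ N⁺ v → x ⟶ y)

  Diclique : Subset order → Subset order → Set
  Diclique V W = Nonempty V × Nonempty W × (∀ v w → v ∈ V → w ∈ W → v ⟶ w)

  infix 4 _⊏_
  _⊏_ : Subset order × Subset order → Subset order × Subset order → Set
  (V , W) ⊏ (V′ , W′) = V ⊆ V′ × W ⊆ W′ × (V , W) ≢ (V′ , W′)

  MaximalDiclique : Subset order → Subset order → Set
  MaximalDiclique V W =
    Diclique V W × (∀ V′ W′ → Diclique V′ W′ → ¬ ((V , W) ⊏ (V′ , W′)))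

  ReducedDiclique : Subset order → Subset order → Set
  ReducedDiclique V W =
    MaximalDiclique V W × (∃₂ λ v w → v ∈ V × w ∈ W × DisimplicialArc v w)

  WDI : Set
  WDI = ∀ v w → v ⟶ w → ∃₂ λ V W → ReducedDiclique V W × v ∈ V × w ∈ W

  -- The partial function θ, given by its graph: θ v ↦ x says that θ is
  -- defined at v with value x.
  θ_↦_ : Vertex → Vertex → Set
  θ v ↦ x = x ∈ N v × (∀ z → z ∈ N v → z ≢ x → d x < d z)

  θ-functional : ∀ {v x y} → θ v ↦ x → θ v ↦ y → x ≡ y
  θ-functional {v} {x} {y} (x∈ , x-min) (y∈ , y-min) with x ≟ y
  ... | yes x≡y = x≡y
  ... | no  x≢y = contradiction (y-min x x∈ x≢y) (<-asym (x-min y y∈ λ y≡x → x≢y (sym y≡x)))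

  θ?_↦_ : Decidable θ_↦_
  θ? v ↦ x = (x ∈? N v) ×-dec
    all? λ z → (z ∈? N v) →-dec (¬? (z ≟ x) →-dec (d x <? d z))

  ThinArc : Vertex → Vertex → Set
  ThinArc v w = v ⟶ w × θ v ↦ w × θ w ↦ v

  thinArc? : Decidable ThinArc
  thinArc? v w = (v ⟶? w) ×-dec ((θ? v ↦ w) ×-dec (θ? w ↦ v))

  -- v ∈ V(M), where M is the set of thin arcs.
  Matched : Vertex → Set
  Matched v = ∃[ w ] (ThinArc v w ⊎ ThinArc w v)

  JoinPair : Vertex × Vertex → Set
  JoinPair (v , w) = (v ≡ w × ¬ Matched v) ⊎ ThinArc v w

  -- The vertices of Join, without repetition.
  joinPairs : List (Vertex × Vertex)
  joinPairs = filter joinPair? (cartesianProduct (allFin order) (allFin order))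
    where
    joinPair? : U.Decidable JoinPair
    joinPair? (v , w) =
      ((v ≟ w) ×-dec ¬? (any? λ u → thinArc? v u ⊎-dec thinArc? u v)) ⊎-dec thinArc? v w

-- Vertex i of Join G stands for the i-th pair of joinPairs.
Join : Digraph → Digraph
Join G = record
  { order = length joinPairs
  ; _⟶_   = λ i j → proj₁ (lookup joinPairs i) ⟶ proj₂ (lookup joinPairs j)
  ; _⟶?_  = λ i j → proj₁ (lookup joinPairs i) ⟶? proj₂ (lookup joinPairs j)
  }
  where open Digraph G

{-# OPTIONS --safe #-}
module Submission where

-- In a twin-free ST graph a disimplicial arc v → w is thin: N(w) ⊆ N(z) for all
-- z ∈ N(v), and without twins the inclusion is proper unless z = w.  Under WDI
-- the converse holds: if x → y is a disimplicial arc in a diclique containing the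
-- thin arc v → w, then x → w and v → y force y = w and x = v by minimality of
-- degrees.  An unmatched vertex, being a source or a sink, is never the middle
-- of a path a → c → b of Join(G), so (i) says that every thin arc is
-- disimplicial, and (ii) then says that every arc shares a diclique with one.

open import Defs
open import Data.Fin.Base using (Fin)
open import Data.Fin.Properties using (_≟_; any?)
open import Data.Fin.Subset using (Subset; _∈_; _⊆_; ∣_∣)
open import Data.Fin.Subset.Properties
  using (_∈?_; ⊆-antisym; p⊂q⇒∣p∣<∣q∣; x∈p∪q⁺; x∈p∪q⁻)
open import Data.List.Base using (allFin; cartesianProduct; lookup)
open import Data.List.Membership.Propositional.Properties
  using (∈-lookup; ∈-filter⁺; ∈-filter⁻; ∈-cartesianProduct⁺; ∈-allFin)
open import Data.List.Relation.Unary.Any using (index)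
open import Data.List.Relation.Unary.Any.Properties using (lookup-index)
open import Data.Nat.Base using (_<_)
open import Data.Nat.Properties using (<-asym)
open import Data.Product.Base using (_×_; _,_; ∃-syntax; proj₁; proj₂)
open import Data.Sum.Base using (inj₁; inj₂)
open import Data.Vec.Base using (tabulate)
open import Data.Vec.Properties using (lookup∘tabulate; lookup⇒[]=; []=⇒lookup)
open import Function.Base using (_∘_)
open import Function.Bundles using (_⇔_; mk⇔)
open import Relation.Binary.PropositionalEquality
  using (_≡_; _≢_; refl; sym; trans; cong₂; subst; subst₂)
open import Relation.Nullary using (¬_; yes; no; does; contradiction)
open import Relation.Nullary.Decidable
  using (¬?; _×-dec_; _⊎-dec_; dec-true; decidable-stable)
import Relation.Unary as U

module _ {n} {P : Fin n → Set} (P? : U.Decidable P) where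

  ∈-tabulate-does⁺ : ∀ {x} → P x → x ∈ tabulate (does ∘ P?)
  ∈-tabulate-does⁺ {x} px =
    lookup⇒[]= x _ (trans (lookup∘tabulate (does ∘ P?) x) (dec-true (P? x) px))

  ∈-tabulate-does⁻ : ∀ {x} → x ∈ tabulate (does ∘ P?) → P x
  ∈-tabulate-does⁻ {x} x∈
    with P? x | trans (sym (lookup∘tabulate (does ∘ P?) x)) ([]=⇒lookup x∈)
  ... | yes px | _ = px
  ... | no  _  | ()

⊆∧≢⇒∣p∣<∣q∣ : ∀ {n} {p q : Subset n} → p ⊆ q → p ≢ q → ∣ p ∣ < ∣ q ∣
⊆∧≢⇒∣p∣<∣q∣ {p = p} {q} p⊆q p≢q with any? (λ x → (x ∈? q) ×-dec ¬? (x ∈? p))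
... | yes x∈q∖p = p⊂q⇒∣p∣<∣q∣ (p⊆q , x∈q∖p)
... | no  q∖p-empty = contradiction (⊆-antisym p⊆q q⊆p) p≢q
  where
  q⊆p : q ⊆ p
  q⊆p {x} x∈q = decidable-stable (x ∈? p) λ x∉p → q∖p-empty (x , x∈q , x∉p)

module _ (G : Digraph) where
  open Digraph G
  private module Join = Digraph (Join G)

  ∈N⁺⁺ : ∀ {v w} → v ⟶ w → w ∈ N⁺ v
  ∈N⁺⁺ {v} = ∈-tabulate-does⁺ (v ⟶?_)

  ∈N⁺⁻ : ∀ {v w} → w ∈ N⁺ v → v ⟶ w
  ∈N⁺⁻ {v} = ∈-tabulate-does⁻ (v ⟶?_)

  ∈N⁻⁺ : ∀ {v w} → v ⟶ w → v ∈ N⁻ w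
  ∈N⁻⁺ {w = w} = ∈-tabulate-does⁺ (_⟶? w)

  ∈N⁻⁻ : ∀ {v w} → v ∈ N⁻ w → v ⟶ w
  ∈N⁻⁻ {w = w} = ∈-tabulate-does⁻ (_⟶? w)

  head∈N : ∀ {v w} → v ⟶ w → w ∈ N v
  head∈N = x∈p∪q⁺ ∘ inj₁ ∘ ∈N⁺⁺

  tail∈N : ∀ {v w} → v ⟶ w → v ∈ N w
  tail∈N = x∈p∪q⁺ ∘ inj₂ ∘ ∈N⁻⁺

  -- Any diclique extending this one still has `v` on its tail side and `w` on its head side, so all
  -- its tails lie in `N⁻ w` and all its heads in `N⁺ v`.
  disimplicial⇒reduced : ∀ {v w} → DisimplicialArc v w → ReducedDiclique (N⁻ w) (N⁺ v)
  disimplicial⇒reduced {v} {w} dis@(v⟶w , full) =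
    (((v , v∈) , (w , w∈) , full) , maximal) , v , w , v∈ , w∈ , dis
    where
    v∈ = ∈N⁻⁺ v⟶w
    w∈ = ∈N⁺⁺ v⟶w
    maximal : ∀ V′ W′ → Diclique V′ W′ → ¬ (N⁻ w , N⁺ v) ⊏ (V′ , W′)
    maximal V′ W′ (_ , _ , full′) (⊆V′ , ⊆W′ , ≢V′W′) = ≢V′W′ (cong₂ _,_
      (⊆-antisym ⊆V′ λ x∈V′ → ∈N⁻⁺ (full′ _ w x∈V′ (⊆W′ w∈)))
      (⊆-antisym ⊆W′ λ y∈W′ → ∈N⁺⁺ (full′ v _ (⊆V′ v∈) y∈W′)))

  JoinVertex : Vertex → Vertex → Set
  JoinVertex v w = ∃[ a ] lookup joinPairs a ≡ (v , w)

  joinVertex⁺ : ∀ {v w} → JoinPair (v , w) → JoinVertex v w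
  joinVertex⁺ {v} {w} p = index vw∈ , sym (lookup-index vw∈)
    where vw∈ = ∈-filter⁺ _ (∈-cartesianProduct⁺ (∈-allFin v) (∈-allFin w)) p

  joinVertex⁻ : ∀ a → JoinPair (lookup joinPairs a)
  joinVertex⁻ a = proj₂ (∈-filter⁻ _ {xs = cartesianProduct (allFin order) (allFin order)}
    (∈-lookup {xs = joinPairs} a))

  joinArc⁺ : ∀ {a b v w x y} → lookup joinPairs a ≡ (v , w) → lookup joinPairs b ≡ (x , y) →
    v ⟶ y → a Join.⟶ b
  joinArc⁺ a≡ b≡ = subst₂ (λ p q → proj₁ p ⟶ proj₂ q) (sym a≡) (sym b≡)

  module _ (st : ST) where

    no-2-path : ∀ {u v w} → u ⟶ v → ¬ v ⟶ w
    no-2-path {u} {v} {w} u⟶v v⟶w with st v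
    ... | inj₁ source = source (u , ∈N⁻⁺ u⟶v)
    ... | inj₂ sink   = sink (w , ∈N⁺⁺ v⟶w)

    ∈N-tail : ∀ {v w z} → v ⟶ w → z ∈ N v → v ⟶ z
    ∈N-tail {v} v⟶w z∈ with x∈p∪q⁻ (N⁺ v) _ z∈
    ... | inj₁ z∈N⁺ = ∈N⁺⁻ z∈N⁺
    ... | inj₂ z∈N⁻ = contradiction v⟶w (no-2-path (∈N⁻⁻ z∈N⁻))

    ∈N-head : ∀ {v w z} → v ⟶ w → z ∈ N w → z ⟶ w
    ∈N-head {w = w} v⟶w z∈ with x∈p∪q⁻ (N⁺ w) _ z∈
    ... | inj₁ z∈N⁺ = contradiction (∈N⁺⁻ z∈N⁺) (no-2-path v⟶w)
    ... | inj₂ z∈N⁻ = ∈N⁻⁻ z∈N⁻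

    -- Lets an arc of `G` be lifted to `Join G`. If `v` is matched, it must be the tail of its thin
    -- arc, since being the head would create a 2-path through `v`; otherwise the pair `(v , v)`
    -- serves.
    joinVertex-tail : ∀ {v w} → v ⟶ w → ∃[ u ] JoinVertex v u
    joinVertex-tail {v} v⟶w with any? (λ u → thinArc? v u ⊎-dec thinArc? u v)
    ... | yes (u , inj₁ thin)      = u , joinVertex⁺ (inj₂ thin)
    ... | yes (u , inj₂ (u⟶v , _)) = contradiction v⟶w (no-2-path u⟶v)
    ... | no  unmatched            = v , joinVertex⁺ (inj₁ (refl , unmatched))

    joinVertex-head : ∀ {v w} → v ⟶ w → ∃[ u ] JoinVertex u w
    joinVertex-head {w = w} v⟶w with any? (λ u → thinArc? w u ⊎-dec thinArc? u w)
    ... | yes (u , inj₁ (w⟶u , _)) = contradiction w⟶u (no-2-path v⟶w)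
    ... | yes (u , inj₂ thin)      = u , joinVertex⁺ (inj₂ thin)
    ... | no  unmatched            = w , joinVertex⁺ (inj₁ (refl , unmatched))

    2-path⇒thin : ∀ {x v w y} → JoinPair (v , w) → x ⟶ w → v ⟶ y → ThinArc v w
    2-path⇒thin (inj₁ (refl , _)) x⟶w v⟶y = contradiction v⟶y (no-2-path x⟶w)
    2-path⇒thin (inj₂ thin)       _   _   = thin

    module _ (twin-free : ∀ v w → ¬ Twins v w) where

      N⊆∧≢⇒d< : ∀ {w z} → N w ⊆ N z → z ≢ w → d w < d z
      N⊆∧≢⇒d< {w} {z} N⊆ z≢w =
        ⊆∧≢⇒∣p∣<∣q∣ N⊆ λ N≡ → twin-free w z (z≢w ∘ sym , N≡)

      disimplicial⇒thin : ∀ {v w} → DisimplicialArc v w → ThinArc v w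
      disimplicial⇒thin {v} {w} (v⟶w , full) = v⟶w
        -- Every `u` in `N w` is a tail and every `z` in `N v` is a head, so `full` supplies the arc
        -- from `u` to `z`. The second half exchanges the two roles.
        , (head∈N v⟶w , λ z z∈ → N⊆∧≢⇒d< λ u∈ →
            tail∈N (full _ z (∈N⁻⁺ (∈N-head v⟶w u∈)) (∈N⁺⁺ (∈N-tail v⟶w z∈))))
        , (tail∈N v⟶w , λ z z∈ → N⊆∧≢⇒d< λ u∈ →
            head∈N (full z _ (∈N⁻⁺ (∈N-head v⟶w z∈)) (∈N⁺⁺ (∈N-tail v⟶w u∈))))

      WDI⇒thin⇒disimplicial : WDI → ∀ {v w} → ThinArc v w → DisimplicialArc v w
      WDI⇒thin⇒disimplicial wdi {v} {w} (v⟶w , θv , θw) with wdi v w v⟶w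
      ... | V , W , (((_ , _ , full) , _) , x , y , x∈V , y∈W , dis) , v∈V , w∈W
        with disimplicial⇒thin dis
      ... | _ , θx , θy = subst₂ DisimplicialArc
              (mutual-θ θw θy (tail∈N x⟶w) (tail∈N v⟶y))
              (mutual-θ θv θx (head∈N v⟶y) (head∈N x⟶w))
              dis
        where
        x⟶w = full x w x∈V w∈W
        v⟶y = full v y v∈V y∈W
        -- Both `s` and `t` are neighbors of `p` and of `q`. If they differed, minimality at `p`
        -- would give `d s < d t` and minimality at `q` the reverse.
        mutual-θ : ∀ {p q s t} → θ p ↦ s → θ q ↦ t → t ∈ N p → s ∈ N q → t ≡ s
        mutual-θ {s = s} {t} (_ , s-min) (_ , t-min) t∈ s∈ = decidable-stable (t ≟ s) λ t≢s →
          <-asym (s-min t t∈ t≢s) (t-min s s∈ (t≢s ∘ sym))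

      -- When `u` stands for a thin arc from `v` to `w`, an arc of the join into `u` is an arc of
      -- `G` into `w`, and one out of `u` is an arc of `G` out of `v`. Transitivity at `u` is thus
      -- an instance of disimpliciality.
      WDI⇒Join-transitive : WDI → Join.Transitive
      WDI⇒Join-transitive wdi u x y x∈ y∈ =
        proj₂ (WDI⇒thin⇒disimplicial wdi (2-path⇒thin (joinVertex⁻ u) x⟶u u⟶y))
          _ _ (∈N⁻⁺ x⟶u) (∈N⁺⁺ u⟶y)
        where
        x⟶u = ∈-tabulate-does⁻ (Join._⟶? u) x∈
        u⟶y = ∈-tabulate-does⁻ (u Join.⟶?_) y∈

      WDI⇒Join-dense : WDI →
        ∀ a b → a Join.⟶ b → ∃[ c ] (a Join.⟶ c × c Join.⟶ b)
      WDI⇒Join-dense wdi a b a⟶b with wdi _ _ a⟶b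
      ... | V , W , (((_ , _ , full) , _) , x , y , x∈V , y∈W , dis) , a∈V , b∈W
        -- The middle vertex is the disimplicial arc from `x` to `y` of the diclique: its head `y`
        -- receives the arc from `a`, its tail `x` sends the one to `b`.
        with joinVertex⁺ (inj₂ (disimplicial⇒thin dis))
      ... | c , c≡ = c , subst (λ p → _ ⟶ proj₂ p) (sym c≡) (full _ y a∈V y∈W)
                       , subst (λ p → proj₁ p ⟶ _) (sym c≡) (full x _ x∈V b∈W)

    Join-transitive⇒thin⇒disimplicial : Join.Transitive →
      ∀ {v w} → ThinArc v w → DisimplicialArc v w
    Join-transitive⇒thin⇒disimplicial transitive {v} {w} thin = proj₁ thin , full
      where
      full : ∀ x y → x ∈ N⁻ w → y ∈ N⁺ v → x ⟶ y
      full x y x∈ y∈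
        -- Transitivity speaks only of join vertices, so `x` is lifted to one with first component
        -- `x`, and `y` to one with second component `y`.
        with joinVertex-tail (∈N⁻⁻ x∈) | joinVertex⁺ (inj₂ thin) | joinVertex-head (∈N⁺⁻ y∈)
      ... | _ , a , a≡ | u , u≡ | _ , b , b≡ =
        subst₂ (λ p q → proj₁ p ⟶ proj₂ q) a≡ b≡ (transitive u a b
          (∈-tabulate-does⁺ (Join._⟶? u)
            (joinArc⁺ a≡ u≡ (∈N⁻⁻ x∈)))
          (∈-tabulate-does⁺ (u Join.⟶?_)
            (joinArc⁺ u≡ b≡ (∈N⁺⁻ y∈))))

    Join-transitive∧dense⇒WDI : Join.Transitive →
      (∀ a b → a Join.⟶ b → ∃[ c ] (a Join.⟶ c × c Join.⟶ b)) →
      WDI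
    Join-transitive∧dense⇒WDI transitive dense v w v⟶w
      with joinVertex-tail v⟶w | joinVertex-head v⟶w
    ... | _ , a , a≡ | _ , b , b≡
      with dense a b (joinArc⁺ a≡ b≡ v⟶w)
    ... | c , a⟶c , c⟶b =
      -- If `c` stands for the pair `(p , q)`, the diclique is `N⁻ q` to `N⁺ p`; it contains `v` and
      -- `w` because `v ⟶ q` and `p ⟶ w`.
      _ , _ , disimplicial⇒reduced
                (Join-transitive⇒thin⇒disimplicial transitive
                  (2-path⇒thin (joinVertex⁻ c) a⟶c c⟶b))
            , ∈N⁻⁺ (subst (λ p → proj₁ p ⟶ _) a≡ a⟶c)
            , ∈N⁺⁺ (subst (λ p → _ ⟶ proj₂ p) b≡ c⟶b)

open Digraph

theorem14 : (G : Digraph) → ST G → (∀ v w → ¬ Twins G v w) →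
    WDI G ⇔
    (Transitive (Join G) ×
    (∀ a b → _⟶_ (Join G) a b → ∃[ c ] (_⟶_ (Join G) a c × _⟶_ (Join G) c b)))
theorem14 G st twin-free = mk⇔
  (λ wdi → WDI⇒Join-transitive G st twin-free wdi , WDI⇒Join-dense G st twin-free wdi)
  (λ (transitive , dense) → Join-transitive∧dense⇒WDI G st transitive dense)
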